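{- Let $G$ be a perfect graph whose edges are colored with two colors. Then $V(G)$ can be covered by the vertex sets of $\alpha(G)$ monochromatic subgraphs of $G$, each of diameter at most $3$.
   Context: Graphs are finite and simple; $\alpha(G)$ is the independence number. A graph $G$ is perfect if every induced subgraph $H$ of $G$ satisfies $\omega(H)=\chi(H)$, where $\omega$ is the clique number and $\chi$ the chromatic number. A monochromatic subgraph is a subgraph (not necessarily induced) all of whose edges have the same color; a single vertex counts as a monochromatic subgraph. Different subgraphs in a cover may have different colors and may overlap. The diameter of a graph $H$ is the smallest integer $d$ with $d_H(u,v)\le d$ for all $u,v\in V(H)$, where distances are measured in $H$ itself ($\infty$ if there is no path); a one-vertex graph has diameter $0$. -}

module Defs where

open import Level using (0ℓ)
open import Data.Nat using (ℕ; zero; suc; _≤_)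
open import Data.Fin using (Fin)
open import Data.Fin.Subset using (Subset; _∈_; Nonempty)
open import Data.Product using (Σ; ∃; ∃-syntax; _×_; proj₁)
open import Function using (_on_)
open import Function.Bundles using (_↣_; Injection)
open import Relation.Binary using (Rel; Symmetric; Irreflexive; Decidable)
open import Relation.Binary.PropositionalEquality using (_≡_; _≢_; cong)
open import Relation.Nullary using (¬_)

IsLeast : (ℕ → Set) → ℕ → Set
IsLeast P k = P k × (∀ m → P m → k ≤ m)

IsGreatest : (ℕ → Set) → ℕ → Set
IsGreatest P k = P k × (∀ m → P m → m ≤ k)

-- Adjacency is decidable so that, constructively, a graph on a finite vertex
-- type really is a finite object.
record Graph (V : Set) : Set₁ where
  field
    Adj    : Rel V 0ℓ
    sym    : Symmetric Adj
    irrefl : Irreflexive _≡_ Adj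
    adj?   : Decidable Adj

open Graph public using (Adj)

Vertices : ∀ {n} → Subset n → Set
Vertices {n} S = Σ (Fin n) (_∈ S)

induced : ∀ {n} → Graph (Fin n) → (S : Subset n) → Graph (Vertices S)
induced G S = record
  { Adj    = Adj G on proj₁
  ; sym    = Graph.sym G
  ; irrefl = λ u≡v → Graph.irrefl G (cong proj₁ u≡v)
  ; adj?   = λ u v → Graph.adj? G (proj₁ u) (proj₁ v)
  }

module _ {V : Set} (H : Graph V) where

  -- A k-element set of vertices is given by an injective enumeration.
  HasClique : ℕ → Set
  HasClique k = Σ (Fin k ↣ V) λ f →
    ∀ i j → i ≢ j → Adj H (Injection.to f i) (Injection.to f j)

  HasIndependentSet : ℕ → Set
  HasIndependentSet k = Σ (Fin k ↣ V) λ f →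
    ∀ i j → ¬ Adj H (Injection.to f i) (Injection.to f j)

  Colourable : ℕ → Set
  Colourable k = Σ (V → Fin k) λ f → ∀ u v → Adj H u v → f u ≢ f v

  IsCliqueNumber : ℕ → Set
  IsCliqueNumber = IsGreatest HasClique

  IsIndependenceNumber : ℕ → Set
  IsIndependenceNumber = IsGreatest HasIndependentSet

  IsChromaticNumber : ℕ → Set
  IsChromaticNumber = IsLeast Colourable

  data Walk : V → V → ℕ → Set where
    []  : ∀ {u} → Walk u u zero
    _∷_ : ∀ {u v w k} → Adj H u v → Walk v w k → Walk u w (suc k)

  -- Infinite distance is the absence of any k with IsDistance u v k.
  IsDistance : V → V → ℕ → Set
  IsDistance u v = IsLeast (Walk u v)

  IsDiameter : ℕ → Set
  IsDiameter = IsLeast λ d → ∀ u v → ∃[ k ] IsDistance u v k × k ≤ d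

  DiameterAtMost : ℕ → Set
  DiameterAtMost b = ∃[ d ] IsDiameter d × d ≤ b

Perfect : ∀ {n} → Graph (Fin n) → Set
Perfect {n} G = (S : Subset n) →
  ∃[ k ] IsCliqueNumber (induced G S) k × IsChromaticNumber (induced G S) k

-- Only edges carry a colour.  Adj may have several proofs, so colour-sym
-- ranges over all proofs in both directions; this also makes the colour
-- independent of the proof.
record EdgeColouring {V : Set} (G : Graph V) (r : ℕ) : Set where
  field
    colour     : ∀ {u v} → Adj G u v → Fin r
    colour-sym : ∀ {u v} (e : Adj G u v) (e′ : Adj G v u) → colour e ≡ colour e′

-- Not necessarily induced.  Subgraphs are nonempty, as the diameter of the
-- null graph is not meaningful.
record Subgraph {n : ℕ} (G : Graph (Fin n)) : Set₁ where
  field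
    verts    : Subset n
    nonempty : Nonempty verts
    graph    : Graph (Vertices verts)
    include  : ∀ {u v} → Adj graph u v → Adj G (proj₁ u) (proj₁ v)

open Subgraph public using (verts; graph; include)

Monochromatic : ∀ {n r} {G : Graph (Fin n)} → EdgeColouring G r → Subgraph G → Set
Monochromatic {r = r} c H = Σ (Fin r) λ x →
  ∀ u v (e : Adj (graph H) u v) → EdgeColouring.colour c (include H e) ≡ x

{-# OPTIONS --safe #-}

-- By Lovász's perfect graph theorem, V(G) is covered by α cliques.  A clique
-- with edges coloured red and blue is spanned by one colour with diameter at
-- most 3: if u and v are at red distance more than 2, then uv is blue and every
-- other vertex sends a blue edge to u or to v.
--
-- The perfect graph theorem is proved without replicating vertices: if every
-- clique has w-weight at most m, then m stable sets cover each vertex x at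
-- least w x times.  If w x ≥ 2, take a covering for w minus one unit at x and a
-- stable set S in it containing x.  Every clique has weight at most m - 1 for
-- w ∸ χ S: a clique through x because x loses weight, any other because it is
-- still served by the remaining m - 1 sets.  So S completes a covering of
-- w ∸ χ S by m - 1 sets.
module Submission where

open import Data.Bool using (true; false; if_then_else_)
open import Data.Fin using (Fin; zero; suc; _≟_)
open import Data.Fin.Properties as Fin using (any?; all?; injective⇒≤)
open import Data.Fin.Subset
  using (Subset; inside; outside; _∈_; _∉_; _⊆_; _∩_; ∁; ⊤; ⊥; ⁅_⁆; ∣_∣; Empty; Nonempty)
open import Data.Fin.Subset.Properties
  using (_∈?_; _⊆?_; nonempty?; anySubset?; ∈⊤; x∈⁅x⁆; x∈⁅y⁆⇒x≡y; x∈p∩q⁺; x∈p∩q⁻;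
         ∉⊥; ∣⁅x⁆∣≡1; p⊆q⇒∣p∣≤∣q∣; Empty-unique; ∣⊥∣≡0; x∉p⇒x∈∁p; x∈∁p⇒x∉p)
open import Data.List using (List; []; _∷_; length; map; _++_; tabulate)
open import Data.List.Membership.Propositional using () renaming (_∈_ to _∈ˡ_)
open import Data.List.Membership.Propositional.Properties using (∈-map⁺; ∈-++⁺ˡ; ∈-++⁺ʳ; ∈-tabulate⁺)
open import Data.List.Properties using (length-tabulate)
open import Data.List.Relation.Unary.All as All using (All; []; _∷_)
import Data.List.Relation.Unary.All.Properties as All
open import Data.List.Relation.Unary.Any using (here; there)
open import Data.Nat
  using (ℕ; zero; suc; pred; _+_; _*_; _∸_; _≤_; _<_; _≤?_; z≤n; s≤s; s≤s⁻¹)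
open import Data.Nat.Properties as ℕ using (≤-refl; ≤-trans; ≤-reflexive; +-mono-≤)
open import Data.Nat.Tactic.RingSolver using (solve-∀)
open import Data.Product as Product using (Σ; ∃; ∃-syntax; _×_; _,_; proj₁; proj₂)
open import Data.Sum using (_⊎_; inj₁; inj₂)
open import Data.Vec as Vec using ([]; _∷_; here; there; lookup)
open import Data.Vec.Properties.WithK using ([]=-irrelevant)
open import Data.Vec.Properties using (lookup⇒[]=; []=⇒lookup; lookup∘tabulate)
open import Data.Vec.Functional using () renaming (_∷_ to _∷ᶠ_)
open import Function using (_∘_; id; case_of_)
open import Function.Bundles using (Injection; mk↣)
open import Relation.Binary.PropositionalEquality
  using (_≡_; _≢_; refl; sym; trans; cong; subst)
open import Relation.Nullary using (Dec; yes; no; does; ¬_; ¬?; contradiction; _×-dec_; _→-dec_)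
open import Relation.Nullary.Decidable using (map′; dec-true; decidable-stable)
open import Relation.Unary using (Decidable)
open import Defs

private variable
  n k m a : ℕ

-- Finite vertex sets: enumeration and decidable search

enum : (S : Subset n) → Fin ∣ S ∣ → Vertices S
enum (inside  ∷ S) zero    = zero , here
enum (inside  ∷ S) (suc i) = Product.map suc there (enum S i)
enum (outside ∷ S) i       = Product.map suc there (enum S i)

index : (S : Subset n) → Vertices S → Fin ∣ S ∣
index (inside  ∷ S) (zero  , here)    = zero
index (inside  ∷ S) (suc x , there p) = suc (index S (x , p))
index (outside ∷ S) (suc x , there p) = index S (x , p)

enum∘index : (S : Subset n) (v : Vertices S) → enum S (index S v) ≡ v
enum∘index (inside  ∷ S) (zero  , here)    = refl
enum∘index (inside  ∷ S) (suc x , there p) = cong (Product.map suc there) (enum∘index S (x , p))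
enum∘index (outside ∷ S) (suc x , there p) = cong (Product.map suc there) (enum∘index S (x , p))

enum-injective : (S : Subset n) {i j : Fin ∣ S ∣} →
                 proj₁ (enum S i) ≡ proj₁ (enum S j) → i ≡ j
enum-injective (inside  ∷ S) {zero}  {zero}  eq = refl
enum-injective (inside  ∷ S) {suc i} {suc j} eq = cong suc (enum-injective S (Fin.suc-injective eq))
enum-injective (outside ∷ S)                 eq = enum-injective S (Fin.suc-injective eq)

index-injective : (S : Subset n) {u v : Vertices S} → index S u ≡ index S v → u ≡ v
index-injective S {u} {v} eq =
  trans (sym (enum∘index S u)) (trans (cong (enum S) eq) (enum∘index S v))

module _ (S : Subset n) {P : Vertices S → Set} (P? : Decidable P) where

  anyVertex? : Dec (∃ P)
  anyVertex? = map′ (Product.map (enum S) id)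
                    (λ (v , p) → index S v , subst P (sym (enum∘index S v)) p)
                    (any? (P? ∘ enum S))

  allVertices? : Dec (∀ v → P v)
  allVertices? = map′ (λ h v → subst P (enum∘index S v) (h (index S v)))
                      (λ h i → h (enum S i))
                      (all? (P? ∘ enum S))

_≟ᵛ_ : {S : Subset n} (u v : Vertices S) → Dec (u ≡ v)
_≟ᵛ_ {S = S} u v = map′ (index-injective S) (cong (index S)) (index S u ≟ index S v)

select : {P : Fin n → Set} → Decidable P → Subset n
select P? = Vec.tabulate (does ∘ P?)

module _ {P : Fin n → Set} (P? : Decidable P) where

  ∈-select⁺ : ∀ {x} → P x → x ∈ select P?
  ∈-select⁺ {x} p = lookup⇒[]= x _ (trans (lookup∘tabulate _ x) (dec-true (P? x) p))

  ∈-select⁻ : ∀ {x} → x ∈ select P? → P x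
  ∈-select⁻ {x} x∈ with P? x | trans (sym (lookup∘tabulate (does ∘ P?) x)) ([]=⇒lookup x∈)
  ... | yes p | _ = p

injective⇒≤∣S∣ : (S : Subset n) (f : Fin k → Fin n) → (∀ {i j} → f i ≡ f j → i ≡ j) →
                 (∀ i → f i ∈ S) → k ≤ ∣ S ∣
injective⇒≤∣S∣ S f inj f∈ =
  injective⇒≤ {f = λ i → index S (f i , f∈ i)} (inj ∘ cong proj₁ ∘ index-injective S)

∣S∣≤1 : (S : Subset n) → (∀ {x y} → x ∈ S → y ∈ S → x ≡ y) → ∣ S ∣ ≤ 1
∣S∣≤1 S unique = injective⇒≤ {f = λ _ → zero {0}} λ {i} {j} _ →
  enum-injective S (unique (proj₂ (enum S i)) (proj₂ (enum S j)))

∣S∣≡0 : (S : Subset n) → Empty S → ∣ S ∣ ≡ 0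
∣S∣≡0 {n} S empty = trans (cong ∣_∣ (Empty-unique empty)) (∣⊥∣≡0 n)

subsets : (n : ℕ) → List (Subset n)
subsets zero    = [] ∷ []
subsets (suc n) = map (inside ∷_) (subsets n) ++ map (outside ∷_) (subsets n)

∈-subsets : (S : Subset n) → S ∈ˡ subsets n
∈-subsets []            = here refl
∈-subsets (inside  ∷ S) = ∈-++⁺ˡ (∈-map⁺ _ (∈-subsets S))
∈-subsets (outside ∷ S) = ∈-++⁺ʳ (map (inside ∷_) (subsets _)) (∈-map⁺ _ (∈-subsets S))

-- Weights of vertex sets and multiplicities in lists of sets

weight : Subset n → (Fin n → ℕ) → ℕ
weight []            w = 0
weight (inside  ∷ S) w = w zero + weight S (w ∘ suc)
weight (outside ∷ S) w = weight S (w ∘ suc)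

χ : Subset n → Fin n → ℕ
χ S x = if lookup S x then 1 else 0

-- Lists let a set occur repeatedly, as coverings with multiplicity require.
count : List (Subset n) → Fin n → ℕ
count []      x = 0
count (S ∷ L) x = χ S x + count L x

weight-mono : (Q : Subset n) {w w′ : Fin n → ℕ} → (∀ {x} → x ∈ Q → w x ≤ w′ x) →
              weight Q w ≤ weight Q w′
weight-mono []            le = z≤n
weight-mono (inside  ∷ Q) le = +-mono-≤ (le here) (weight-mono Q (le ∘ there))
weight-mono (outside ∷ Q) le = weight-mono Q (le ∘ there)

weight-mono-< : (Q : Subset n) {w w′ : Fin n → ℕ} → (∀ {x} → x ∈ Q → w x ≤ w′ x) →
                ∀ {x} → x ∈ Q → w x < w′ x → weight Q w < weight Q w′
weight-mono-< (inside  ∷ Q) le here      lt = ℕ.+-mono-<-≤ lt (weight-mono Q (le ∘ there))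
weight-mono-< (inside  ∷ Q) le (there p) lt =
  ℕ.+-mono-≤-< (le here) (weight-mono-< Q (le ∘ there) p lt)
weight-mono-< (outside ∷ Q) le (there p) lt = weight-mono-< Q (le ∘ there) p lt

weight-0 : (Q : Subset n) → weight Q (λ _ → 0) ≡ 0
weight-0 []            = refl
weight-0 (inside  ∷ Q) = weight-0 Q
weight-0 (outside ∷ Q) = weight-0 Q

weight-+ : (Q : Subset n) (w w′ : Fin n → ℕ) →
           weight Q (λ x → w x + w′ x) ≡ weight Q w + weight Q w′
weight-+ []            w w′ = refl
weight-+ (inside  ∷ Q) w w′ rewrite weight-+ Q (w ∘ suc) (w′ ∘ suc) =
  interchange (w zero) (w′ zero) (weight Q (w ∘ suc)) (weight Q (w′ ∘ suc))
  where
  interchange : ∀ a b c d → (a + b) + (c + d) ≡ (a + c) + (b + d)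
  interchange = solve-∀
weight-+ (outside ∷ Q) w w′ = weight-+ Q (w ∘ suc) (w′ ∘ suc)

weight-χ : (Q S : Subset n) → weight Q (χ S) ≡ ∣ Q ∩ S ∣
weight-χ []            []            = refl
weight-χ (inside  ∷ Q) (inside  ∷ S) = cong suc (weight-χ Q S)
weight-χ (inside  ∷ Q) (outside ∷ S) = weight-χ Q S
weight-χ (outside ∷ Q) (_       ∷ S) = weight-χ Q S

∣Q∣≤weight : (Q : Subset n) (w : Fin n → ℕ) → (∀ {x} → x ∈ Q → 1 ≤ w x) → ∣ Q ∣ ≤ weight Q w
∣Q∣≤weight []            w pos = z≤n
∣Q∣≤weight (inside  ∷ Q) w pos = +-mono-≤ (pos here) (∣Q∣≤weight Q (w ∘ suc) (pos ∘ there))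
∣Q∣≤weight (outside ∷ Q) w pos = ∣Q∣≤weight Q (w ∘ suc) (pos ∘ there)

χ-∈ : {S : Subset n} {x : Fin n} → x ∈ S → χ S x ≡ 1
χ-∈ x∈S rewrite []=⇒lookup x∈S = refl

χ-∉ : {S : Subset n} {x : Fin n} → x ∉ S → χ S x ≡ 0
χ-∉ {S = S} {x} x∉S with lookup S x in eq
... | true  = contradiction (lookup⇒[]= x S eq) x∉S
... | false = refl

-- Double counting: iterated along the list, this turns the weight of `Q` into the sum of its
-- intersections with the members, which the bounds below estimate term by term.
weight-count-∷ : (Q S : Subset n) (L : List (Subset n)) →
                 weight Q (count (S ∷ L)) ≡ ∣ Q ∩ S ∣ + weight Q (count L)
weight-count-∷ Q S L = trans (weight-+ Q (χ S) (count L)) (cong (_+ _) (weight-χ Q S))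

weight-count≤ : (Q : Subset n) (L : List (Subset n)) → All (λ S → ∣ Q ∩ S ∣ ≤ a) L →
                weight Q (count L) ≤ length L * a
weight-count≤ Q []      []         = ≤-reflexive (weight-0 Q)
weight-count≤ Q (S ∷ L) (le ∷ les) =
  ≤-trans (≤-reflexive (weight-count-∷ Q S L)) (+-mono-≤ le (weight-count≤ Q L les))

weight-count≥ : (Q : Subset n) (L : List (Subset n)) → All (λ S → a ≤ ∣ Q ∩ S ∣) L →
                length L * a ≤ weight Q (count L)
weight-count≥ Q []      []         = z≤n
weight-count≥ Q (S ∷ L) (le ∷ les) =
  ≤-trans (+-mono-≤ le (weight-count≥ Q L les)) (≤-reflexive (sym (weight-count-∷ Q S L)))

weight-count≤1 : (Q : Subset n) (L : List (Subset n)) → All (λ S → ∣ Q ∩ S ∣ ≤ 1) L →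
                 weight Q (count L) ≤ length L
weight-count≤1 Q L les = subst (weight Q (count L) ≤_) (ℕ.*-identityʳ _) (weight-count≤ Q L les)

-- The member disjoint from `Q` contributes nothing, which saves a unit against one per set.
weight-count< : (Q : Subset n) (L : List (Subset n)) → All (λ S → ∣ Q ∩ S ∣ ≤ 1) L →
                ∀ {S} → S ∈ˡ L → ∣ Q ∩ S ∣ ≡ 0 → weight Q (count L) < length L
weight-count< Q (S ∷ L) (_ ∷ les) (here refl) eq
  rewrite weight-count-∷ Q S L | eq = s≤s (weight-count≤1 Q L les)
weight-count< Q (S ∷ L) (le ∷ les) (there S∈) eq
  rewrite weight-count-∷ Q S L = ℕ.+-mono-≤-< le (weight-count< Q L les S∈ eq)

∈⇒1≤count : {L : List (Subset n)} {S : Subset n} {x : Fin n} → S ∈ˡ L → x ∈ S → 1 ≤ count L x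
∈⇒1≤count {L = S ∷ L} (here refl) x∈S rewrite χ-∈ x∈S = s≤s z≤n
∈⇒1≤count {L = S ∷ L} (there S∈)  x∈S = ≤-trans (∈⇒1≤count S∈ x∈S) (ℕ.m≤n+m _ (χ S _))

-- Isolates a set through `x` for reuse; the count equation records exactly what the remaining list
-- has lost.
extract : {P : Subset n → Set} (L : List (Subset n)) → All P L → (x : Fin n) → 1 ≤ count L x →
          Σ (Subset n) λ S → Σ (List (Subset n)) λ L′ →
          x ∈ S × P S × All P L′ × length L ≡ suc (length L′) ×
          (∀ y → count L y ≡ χ S y + count L′ y)
extract (S ∷ L) (p ∷ ps) x pos with x ∈? S
... | yes x∈S = S , L , x∈S , p , ps , refl , λ _ → refl
... | no  x∉S with extract L ps x (subst (λ z → 1 ≤ z + count L x) (χ-∉ x∉S) pos)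
...   | T , L′ , x∈T , q , qs , len , eq =
  T , S ∷ L′ , x∈T , q , p ∷ qs , cong suc len ,
  λ y → trans (cong (χ S y +_) (eq y)) (swap (χ S y) (χ T y) (count L′ y))
  where
  swap : ∀ a b c → a + (b + c) ≡ b + (a + c)
  swap = solve-∀

-- `pred` truncates at zero, so `k ≤ pred m` alone would permit `k = m = 0`; the first hypothesis
-- makes `m` positive.
≤pred⇒< : ∀ {j} → j < m → k ≤ pred m → k < m
≤pred⇒< {m = suc m} _ k≤m = s≤s k≤m

-- Cliques, stable sets and weighted coverings

module _ (G : Graph (Fin n)) where

  IsClique IsStable : Subset n → Set
  IsClique Q = ∀ x y → x ∈ Q → y ∈ Q → x ≢ y → Adj G x y
  IsStable S = ∀ x y → x ∈ S → y ∈ S → ¬ Adj G x y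

  isClique? : Decidable IsClique
  isClique? Q = all? λ x → all? λ y →
    x ∈? Q →-dec y ∈? Q →-dec ¬? (x ≟ y) →-dec Graph.adj? G x y

  isStable? : Decidable IsStable
  isStable? S = all? λ x → all? λ y → x ∈? S →-dec y ∈? S →-dec ¬? (Graph.adj? G x y)

  IsStable-⊆ : {S T : Subset n} → S ⊆ T → IsStable T → IsStable S
  IsStable-⊆ S⊆T st x y x∈ y∈ = st x y (S⊆T x∈) (S⊆T y∈)

  ∣clique∩stable∣≤1 : {Q S : Subset n} → IsClique Q → IsStable S → ∣ Q ∩ S ∣ ≤ 1
  ∣clique∩stable∣≤1 {Q} {S} cl st = ∣S∣≤1 (Q ∩ S) unique
    where
    unique : ∀ {x y} → x ∈ Q ∩ S → y ∈ Q ∩ S → x ≡ y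
    unique {x} {y} x∈ y∈ with x ≟ y | x∈p∩q⁻ Q S x∈ | x∈p∩q⁻ Q S y∈
    ... | yes x≡y | _          | _          = x≡y
    ... | no  x≢y | x∈Q , x∈S | y∈Q , y∈S =
      contradiction (cl x y x∈Q y∈Q x≢y) (st x y x∈S y∈S)

  Covering : (Fin n → ℕ) → ℕ → Set
  Covering w m = Σ (List (Subset n)) λ L →
    All IsStable L × length L ≤ m × (∀ x → w x ≤ count L x)

  -- Any covering forces this bound, because a stable set meets a clique at most once; for a perfect
  -- graph `covering` gives the converse.
  CliqueBound : (Fin n → ℕ) → ℕ → Set
  CliqueBound w m = ∀ Q → IsClique Q → weight Q w ≤ m

  module _ (S : Subset n) where

    -- The `k` vertices of the clique each weigh at least 1, so their image in `Fin n` is a clique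
    -- of weight at least `k`.
    hasClique⇒≤ : HasClique (induced G S) k → (w : Fin n → ℕ) → (∀ {x} → x ∈ S → 1 ≤ w x) →
                  CliqueBound w m → k ≤ m
    hasClique⇒≤ (f , adj) w pos bound =
      ≤-trans (injective⇒≤∣S∣ image to (λ eq → injective (eqᵛ eq)) λ i → ∈-select⁺ image? (i , refl))
        (≤-trans (∣Q∣≤weight image w λ x∈ → case ∈-select⁻ image? x∈ of λ where
                   (i , refl) → pos (proj₂ (Injection.to f i)))
                 (bound image clique))
      where
      open Injection f using (injective)
      to : Fin _ → Fin n
      to = proj₁ ∘ Injection.to f
      -- Injectivity of `f` concerns pairs; as membership proofs are unique, it passes to the
      -- underlying vertices.
      eqᵛ : {u v : Vertices S} → proj₁ u ≡ proj₁ v → u ≡ v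
      eqᵛ {_ , p} {_ , q} refl = cong (_ ,_) ([]=-irrelevant p q)
      image? : Decidable (λ x → ∃[ i ] to i ≡ x)
      image? x = any? λ i → to i ≟ x
      image : Subset n
      image = select image?
      clique : IsClique image
      clique x y x∈ y∈ x≢y with ∈-select⁻ image? x∈ | ∈-select⁻ image? y∈
      ... | i , refl | j , refl = adj i j λ { refl → x≢y refl }

    -- The colour classes of the induced subgraph, read as subsets of all vertices, remain stable in
    -- `G`.
    colourable⇒covering : Colourable (induced G S) k →
                          Σ (List (Subset n)) λ L → All IsStable L × length L ≡ k ×
                          (∀ {x} → x ∈ S → 1 ≤ count L x)
    colourable⇒covering {k} (f , proper) =
      tabulate class , All.tabulate⁺ stable , length-tabulate class ,
      λ {x} x∈ → ∈⇒1≤count (∈-tabulate⁺ (f (x , x∈))) (∈-select⁺ (inClass? _) ((x , x∈) , refl , refl))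
      where
      InClass : Fin k → Fin n → Set
      InClass i x = ∃[ v ] proj₁ v ≡ x × f v ≡ i
      inClass? : ∀ i → Decidable (InClass i)
      inClass? i x = anyVertex? S λ v → proj₁ v ≟ x ×-dec f v ≟ i
      class : Fin k → Subset n
      class i = select (inClass? i)
      stable : ∀ i → IsStable (class i)
      stable i x y x∈ y∈ e with ∈-select⁻ (inClass? i) x∈ | ∈-select⁻ (inClass? i) y∈
      ... | u , refl , fu≡i | v , refl , fv≡i = proper u v e (trans fu≡i (sym fv≡i))

  -- Integer-weighted coverings in perfect graphs

  module _ (perfect : Perfect G) where

    -- Perfection is applied to the support of `w`: the number of colours equals the clique number,
    -- which the clique bound keeps at most `m`, and one class per vertex meets a demand of at most
    -- 1.
    covering-01 : (w : Fin n → ℕ) → (∀ x → w x ≤ 1) → CliqueBound w m → Covering w m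
    covering-01 {m} w w≤1 bound with perfect (select λ x → 1 ≤? w x)
    ... | k , (clique , _) , (colouring , _)
      with colourable⇒covering _ colouring
    ...   | L , stable , len , covers = L , stable , length≤ , covers′
      where
      supp? : Decidable (λ x → 1 ≤ w x)
      supp? x = 1 ≤? w x
      length≤ : length L ≤ m
      length≤ = subst (_≤ m) (sym len) (hasClique⇒≤ _ clique w (∈-select⁻ supp?) bound)
      covers′ : ∀ x → w x ≤ count L x
      covers′ x with supp? x
      ... | yes pos = ≤-trans (w≤1 x) (covers (∈-select⁺ supp? pos))
      ... | no ¬pos = ≤-trans (s≤s⁻¹ (ℕ.≰⇒> ¬pos)) z≤n

    -- Recursion is on `N`, a strict bound on the total weight: both recursive calls lower the
    -- weight at `x`, but neither is structurally smaller.
    covering-fuel : ∀ N {m} w → weight ⊤ w < N → CliqueBound w m → Covering w m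
    covering-fuel (suc N) {m} w (s≤s total≤N) bound with any? (λ x → 2 ≤? w x)
    ... | no none = covering-01 w (λ x → s≤s⁻¹ (ℕ.≰⇒> (λ 2≤wx → none (x , 2≤wx)))) bound
    ... | yes (x , 2≤wx) = extend
      (covering-fuel N (w ⊖ ⁅ x ⁆) (smaller (x∈⁅x⁆ x))
        (λ Q cl → ≤-trans (weight-mono Q (λ _ → ⊖≤ ⁅ x ⁆)) (bound Q cl)))
      where
      _⊖_ : (Fin n → ℕ) → Subset n → Fin n → ℕ
      (v ⊖ S) y = v y ∸ χ S y

      ⊖≤ : (S : Subset n) → ∀ {y} → (w ⊖ S) y ≤ w y
      ⊖≤ S {y} = ℕ.m∸n≤m (w y) (χ S y)

      drops : {S : Subset n} → x ∈ S → (w ⊖ S) x < w x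
      drops x∈S rewrite χ-∈ x∈S = ℕ.∸-monoʳ-< (s≤s z≤n) (≤-trans (ℕ.n≤1+n 1) 2≤wx)

      smaller : {S : Subset n} → x ∈ S → weight ⊤ (w ⊖ S) < N
      smaller {S} x∈S = ≤-trans (weight-mono-< (⊤ {n}) (λ _ → ⊖≤ S) ∈⊤ (drops x∈S)) total≤N

      extend : Covering (w ⊖ ⁅ x ⁆) m → Covering w m
      extend (L , stable , len≤m , covers) with extract L stable x pos
        where
        -- The threshold 2 matters here: after losing a unit, `x` still has positive weight, so some
        -- set of `L` contains it.
        pos : 1 ≤ count L x
        pos = ≤-trans
          (subst (λ z → 1 ≤ w x ∸ z) (sym (χ-∈ (x∈⁅x⁆ x))) (ℕ.∸-monoˡ-≤ 1 2≤wx)) (covers x)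
      ... | S , L′ , x∈S , stableS , stableL′ , len , count≡ =
        reinsert (covering-fuel N (w ⊖ S) (smaller x∈S) bound′)
        where
        len′ : suc (length L′) ≤ m
        len′ = subst (_≤ m) len len≤m

        bound′ : CliqueBound (w ⊖ S) (pred m)
        bound′ Q cl with x ∈? Q
        ... | yes x∈Q = ℕ.<⇒≤pred
          (≤-trans (weight-mono-< Q (λ _ → ⊖≤ S) x∈Q (drops x∈S)) (bound Q cl))
        ... | no  x∉Q =
          ≤-trans (weight-mono Q rest)
            (≤-trans (weight-count≤1 Q L′ (All.map (∣clique∩stable∣≤1 cl) stableL′))
                     (ℕ.<⇒≤pred len′))
          where
          -- Away from `x` the list `L` serves `w` in full, so after taking out the share of `S` the
          -- rest is met by `L′`.
          rest : ∀ {y} → y ∈ Q → w y ∸ χ S y ≤ count L′ y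
          rest {y} y∈Q = ℕ.m≤n+o⇒m∸n≤o (w y) (χ S y)
            (subst (w y ≤_) (count≡ y)
              (subst (λ z → w y ∸ z ≤ count L y)
                     (χ-∉ λ y∈⁅x⁆ → x∉Q (subst (_∈ Q) (x∈⁅y⁆⇒x≡y x y∈⁅x⁆) y∈Q))
                     (covers y)))

        reinsert : Covering (w ⊖ S) (pred m) → Covering w m
        reinsert (M , stableM , lenM , coversM) =
          S ∷ M , stableS ∷ stableM ,
          -- `L` contained `S`, so `m` is positive and `pred m` sets leave room for one more.
          ≤pred⇒< len′ lenM ,
          λ y → ≤-trans (ℕ.m≤n+m∸n (w y) (χ S y)) (ℕ.+-monoʳ-≤ (χ S y) (coversM y))

    covering : (w : Fin n → ℕ) → CliqueBound w m → Covering w m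
    covering w = covering-fuel (suc (weight ⊤ w)) w ≤-refl

    -- Transversal cliques and clique covers

    -- Bounds the independence number of the subgraph induced on `U`, phrased inside `G` so that the
    -- induction can shrink `U` and keep `G`.
    StableBound : Subset n → ℕ → Set
    StableBound U a = ∀ S → IsStable S → S ⊆ U → ∣ S ∣ ≤ a

    -- Weigh each vertex by the number of sets S Q containing it.  Every clique Q
    -- meets each of these t sets at most once and misses S Q, so it weighs less
    -- than t and t - 1 stable sets cover; but U has weight at least t (a + 1), and
    -- the t - 1 sets cover at most (t - 1) (a + 1) of it.
    ¬allAvoidable : (U : Subset n) → StableBound U (suc a) →
                    ¬ (∀ Q → ∃[ S ] IsStable S × S ⊆ U × suc a ≤ ∣ S ∣ ×
                                   (IsClique Q → ∣ Q ∩ S ∣ ≡ 0))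
    ¬allAvoidable {a} U bound avoid =
      ℕ.<⇒≱ (ℕ.*-monoˡ-< (suc a) t-1<t)
        (≤-trans lower (≤-trans (weight-mono U (λ _ → covers _)) upper))
      where
      S : Subset n → Subset n
      S = proj₁ ∘ avoid
      all : List (Subset n)
      all = map S (subsets n)
      stable-all : All IsStable all
      stable-all = All.map⁺ (All.universal (proj₁ ∘ proj₂ ∘ avoid) (subsets n))
      cliques : ∀ Q → IsClique Q → weight Q (count all) < length all
      cliques Q cl = weight-count< Q all (All.map (∣clique∩stable∣≤1 cl) stable-all)
        (∈-map⁺ S (∈-subsets Q)) (proj₂ (proj₂ (proj₂ (proj₂ (avoid Q)))) cl)
      cov : Covering (count all) (pred (length all))
      cov = covering (count all) λ Q cl → ℕ.<⇒≤pred (cliques Q cl)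
      covers : ∀ x → count all x ≤ count (proj₁ cov) x
      covers = proj₂ (proj₂ (proj₂ cov))
      t-1<t : length (proj₁ cov) < length all
      -- The empty clique shows that `all` has positive length, so `pred` is a genuine decrease.
      t-1<t = ≤pred⇒< (cliques ⊥ λ _ _ x∈⊥ → contradiction x∈⊥ ∉⊥) (proj₁ (proj₂ (proj₂ cov)))
      lower : length all * suc a ≤ weight U (count all)
      lower = weight-count≥ U all (All.map⁺ (All.universal large (subsets n)))
        where
        large : ∀ Q → suc a ≤ ∣ U ∩ S Q ∣
        large Q with avoid Q
        ... | T , _ , T⊆U , size , _ = ≤-trans size (p⊆q⇒∣p∣≤∣q∣ λ x∈T → x∈p∩q⁺ (T⊆U x∈T , x∈T))
      upper : weight U (count (proj₁ cov)) ≤ length (proj₁ cov) * suc a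
      upper = weight-count≤ U (proj₁ cov) (All.map small (proj₁ (proj₂ cov)))
        where
        small : ∀ {T} → IsStable T → ∣ U ∩ T ∣ ≤ suc a
        small {T} st = bound (U ∩ T) (IsStable-⊆ (λ x∈ → proj₂ (x∈p∩q⁻ U T x∈)) st)
                                     (λ x∈ → proj₁ (x∈p∩q⁻ U T x∈))

    Avoiding : Subset n → ℕ → Subset n → Subset n → Set
    Avoiding U a Q S = IsStable S × S ⊆ U ∩ ∁ Q × suc a ≤ ∣ S ∣

    avoiding? : (U : Subset n) (a : ℕ) (Q : Subset n) → Decidable (Avoiding U a Q)
    avoiding? U a Q S = isStable? S ×-dec S ⊆? (U ∩ ∁ Q) ×-dec suc a ≤? ∣ S ∣

    -- Otherwise every clique would be missed by a stable subset of `U` with more than `a` vertices,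
    -- contrary to `¬allAvoidable`. Finite search makes the case split constructive.
    transversalClique : (U : Subset n) → StableBound U (suc a) →
                        ∃[ Q ] IsClique Q × StableBound (U ∩ ∁ Q) a
    transversalClique {a} U bound
      with anySubset? (λ Q → isClique? Q ×-dec ¬? (anySubset? (avoiding? U a Q)))
    ... | yes (Q , cl , none) =
      Q , cl , λ S st S⊆ → s≤s⁻¹ (ℕ.≰⇒> λ a<∣S∣ → none (S , st , S⊆ , a<∣S∣))
    ... | no none = contradiction avoid (¬allAvoidable U bound)
      where
      avoidClique : ∀ Q → IsClique Q → ∃ (Avoiding U a Q)
      avoidClique Q cl = decidable-stable (anySubset? (avoiding? U a Q)) λ ¬a → none (Q , cl , ¬a)
      avoid : ∀ Q → ∃[ S ] IsStable S × S ⊆ U × suc a ≤ ∣ S ∣ × (IsClique Q → ∣ Q ∩ S ∣ ≡ 0)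
      avoid Q with isClique? Q
      ... | yes cl with avoidClique Q cl
      ...   | S , st , S⊆ , size =
        S , st , (λ x∈ → proj₁ (x∈p∩q⁻ U _ (S⊆ x∈))) , size , λ _ → ∣S∣≡0 (Q ∩ S) λ (x , x∈) →
          case x∈p∩q⁻ Q S x∈ of λ (x∈Q , x∈S) →
            x∈∁p⇒x∉p (proj₂ (x∈p∩q⁻ U _ (S⊆ x∈S))) x∈Q
      avoid Q | no ¬cl with avoidClique ⊥ (λ _ _ x∈⊥ → contradiction x∈⊥ ∉⊥)
      -- For a non-clique any large stable set will do; avoiding `⊥` supplies one, so that a set is
      -- chosen for every subset.
      ...   | S , st , S⊆ , size =
        S , st , (λ x∈ → proj₁ (x∈p∩q⁻ U _ (S⊆ x∈))) , size , λ cl → contradiction cl ¬cl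

    -- Removing a transversal clique lowers the stable bound by one, so `a` removals exhaust `U`.
    cliqueCover : ∀ a (U : Subset n) → StableBound U a →
                  Σ (Fin a → Subset n) λ Q → (∀ i → IsClique (Q i)) × (∀ {x} → x ∈ U → ∃[ i ] x ∈ Q i)
    -- A vertex of `U` would form a stable singleton exceeding the bound 0, so `U` is empty.
    cliqueCover zero U bound = (λ ()) , (λ ()) , λ {x} x∈U →
      contradiction (bound ⁅ x ⁆ (single x) (λ y∈ → subst (_∈ U) (sym (x∈⁅y⁆⇒x≡y x y∈)) x∈U))
                    (ℕ.<⇒≱ (≤-reflexive (sym (∣⁅x⁆∣≡1 x))))
      where
      single : ∀ x → IsStable ⁅ x ⁆
      single x y z y∈ z∈ = Graph.irrefl G (trans (x∈⁅y⁆⇒x≡y x y∈) (sym (x∈⁅y⁆⇒x≡y x z∈)))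
    cliqueCover (suc a) U bound with transversalClique U bound
    ... | Q , cl , bound′ with cliqueCover a (U ∩ ∁ Q) bound′
    ...   | Qs , cls , covers = Q ∷ᶠ Qs , (λ { zero → cl ; (suc i) → cls i }) , covers′
      where
      covers′ : ∀ {x} → x ∈ U → ∃[ i ] x ∈ (Q ∷ᶠ Qs) i
      covers′ {x} x∈U with x ∈? Q
      ... | yes x∈Q = zero , x∈Q
      ... | no  x∉Q = Product.map suc id (covers (x∈p∩q⁺ (x∈U , x∉p⇒x∈∁p x∉Q)))

-- Walks, distances and diameter

-- `IsDistance` and `IsDiameter` demand true minima; a known witness `b` bounds the search for one.
isLeast : {P : ℕ → Set} → Decidable P → ∀ b → P b → ∃[ k ] IsLeast P k × k ≤ b
isLeast P? b       p with P? 0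
isLeast P? b       p | yes p₀ = 0 , (p₀ , λ _ _ → z≤n) , z≤n
isLeast P? zero    p | no ¬p₀ = contradiction p ¬p₀
isLeast P? (suc b) p | no ¬p₀ with isLeast (P? ∘ suc) b p
... | k , (pₖ , min) , k≤b =
  suc k , (pₖ , λ { zero p₀ → contradiction p₀ ¬p₀ ; (suc m) pₘ → s≤s (min m pₘ) }) , s≤s k≤b

module _ {V : Set} (H : Graph V) where

  -- Leaving out minimality lets the bounds add up under concatenation of walks.
  Within : ℕ → V → V → Set
  Within d u v = ∃[ k ] k ≤ d × Walk H u v k

module _ {V : Set} {H : Graph V} where

  _∷ʳ_ : ∀ {u v w} → Walk H u v k → Adj H v w → Walk H u w (suc k)
  []      ∷ʳ e = e ∷ []
  (f ∷ p) ∷ʳ e = f ∷ (p ∷ʳ e)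

  walk-sym : ∀ {u v} → Walk H u v k → Walk H v u k
  walk-sym []      = []
  walk-sym (e ∷ p) = walk-sym p ∷ʳ Graph.sym H e

  walk-trans : ∀ {u v w} → Walk H u v k → Walk H v w m → Walk H u w (k + m)
  walk-trans []      q = q
  walk-trans (e ∷ p) q = e ∷ walk-trans p q

  within-sym : ∀ {u v} → Within H k u v → Within H k v u
  within-sym (j , j≤k , p) = j , j≤k , walk-sym p

  within-trans : ∀ {u v w} → Within H k u v → Within H m v w → Within H (k + m) u w
  within-trans (_ , j≤k , p) (_ , i≤m , q) = _ , +-mono-≤ j≤k i≤m , walk-trans p q

  within-mono : ∀ {u v} → k ≤ m → Within H k u v → Within H m u v
  within-mono k≤m (j , j≤k , p) = j , ≤-trans j≤k k≤m , p

module _ {S : Subset n} (H : Graph (Vertices S)) where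

  walk? : ∀ k u v → Dec (Walk H u v k)
  walk? zero    u v = map′ (λ { refl → [] }) (λ { [] → refl }) (u ≟ᵛ v)
  walk? (suc k) u v =
    map′ (λ (_ , e , p) → e ∷ p) (λ { (e ∷ p) → _ , e , p })
         (anyVertex? S λ w → Graph.adj? H u w ×-dec walk? k w v)

  within? : ∀ d u v → Dec (Within H d u v)
  within? d u v =
    map′ (λ (k , k<1+d , p) → k , s≤s⁻¹ k<1+d , p) (λ (k , k≤d , p) → k , s≤s k≤d , p)
         (ℕ.anyUpTo? (λ k → walk? k u v) (suc d))

  -- The given walks bound the search for each exact distance, and `b` then bounds the search for
  -- the diameter.
  diameterAtMost : ∀ {b} → (∀ u v → Within H b u v) → DiameterAtMost H b
  diameterAtMost {b} within = isLeast diameter? b distance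
    where
    distance : ∀ u v → ∃[ k ] IsDistance H u v k × k ≤ b
    distance u v with within u v
    ... | j , j≤b , p with isLeast (λ k → walk? k u v) j p
    ...   | k , dist , k≤j = k , dist , ≤-trans k≤j j≤b
    distance? : ∀ d u v → Dec (∃[ k ] IsDistance H u v k × k ≤ d)
    distance? d u v with distance u v
    ... | k , dist , _ =
      map′ (λ k≤d → k , dist , k≤d)
           (λ (j , (p , _) , j≤d) → ≤-trans (proj₂ dist j p) j≤d)
           (k ≤? d)
    diameter? : ∀ d → Dec (∀ u v → ∃[ k ] IsDistance H u v k × k ≤ d)
    diameter? d = allVertices? S λ u → allVertices? S λ v → distance? d u v

-- Colour classes as monochromatic subgraphs

module _ {r} {G : Graph (Fin n)} (c : EdgeColouring G r) where
  open EdgeColouring c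

  -- Both proofs are compared with a reversed edge, where `colour-sym` applies.
  colour-irrelevant : ∀ {u v} (e e′ : Adj G u v) → colour e ≡ colour e′
  colour-irrelevant e e′ = trans (colour-sym e (Graph.sym G e)) (sym (colour-sym e′ (Graph.sym G e)))

  colourGraph : Fin r → (S : Subset n) → Graph (Vertices S)
  colourGraph x S = record
    { Adj    = λ u v → Σ (Adj G (proj₁ u) (proj₁ v)) λ e → colour e ≡ x
    ; sym    = λ (e , eq) → Graph.sym G e , trans (colour-sym (Graph.sym G e) e) eq
    ; irrefl = λ u≡v (e , _) → Graph.irrefl G (cong proj₁ u≡v) e
    ; adj?   = adj?
    }
    where
    adj? : ∀ u v → Dec (Σ (Adj G (proj₁ u) (proj₁ v)) λ e → colour e ≡ x)
    adj? u v with Graph.adj? G (proj₁ u) (proj₁ v)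
    ... | no ¬e = no (¬e ∘ proj₁)
    -- Testing the single proof `e` decides the matter, as the colour does not depend on the proof.
    ... | yes e = map′ (e ,_) (λ (e′ , eq) → trans (colour-irrelevant e e′) eq) (colour e ≟ x)

  colourSubgraph : Fin r → (S : Subset n) → Nonempty S → Subgraph G
  colourSubgraph x S ne = record
    { verts = S ; nonempty = ne ; graph = colourGraph x S ; include = proj₁ }

  colourSubgraph-monochromatic : ∀ x S ne → Monochromatic c (colourSubgraph x S ne)
  colourSubgraph-monochromatic x S ne = x , λ u v (e , eq) → eq

-- Two-coloured cliques

module _ {G : Graph (Fin n)} (c : EdgeColouring G 2) {Q : Subset n} (clique : IsClique G Q) where
  open EdgeColouring c

  Red Blue : Graph (Vertices Q)
  Red  = colourGraph c zero Q
  Blue = colourGraph c (suc zero) Q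

  red⊎blue : ∀ u v → u ≢ v → Adj Red u v ⊎ Adj Blue u v
  red⊎blue u@(x , x∈Q) v@(y , y∈Q) u≢v = split (clique x y x∈Q y∈Q x≢y)
    where
    x≢y : x ≢ y
    x≢y refl = u≢v (cong (x ,_) ([]=-irrelevant x∈Q y∈Q))
    split : Adj G x y → Adj Red u v ⊎ Adj Blue u v
    split e with colour e in eq
    ... | zero     = inj₁ (e , eq)
    ... | suc zero = inj₂ (e , eq)

  blueWithin3 : ∀ u v → ¬ Within Red 2 u v → ∀ x y → Within Blue 3 x y
  blueWithin3 u v far x y = join (near x) (near y)
    where
    edge : ∀ {x y} → Adj Blue x y → Within Blue 1 x y
    edge e = 1 , ≤-refl , e ∷ []

    near : ∀ x → Within Blue 1 x u ⊎ Within Blue 1 x v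
    near x with x ≟ᵛ u | x ≟ᵛ v
    ... | yes refl | _        = inj₁ (0 , z≤n , [])
    ... | no _     | yes refl = inj₂ (0 , z≤n , [])
    ... | no x≢u   | no x≢v with red⊎blue x u x≢u | red⊎blue x v x≢v
    ...   | inj₂ xu | _       = inj₁ (edge xu)
    ...   | inj₁ _  | inj₂ xv = inj₂ (edge xv)
    -- Two red edges at `x` would form a red walk of length 2 from `u` to `v`.
    ...   | inj₁ xu | inj₁ xv =
      contradiction (2 , ≤-refl , _∷_ {v = x} (Graph.sym Red {x} {u} xu) (xv ∷ [])) far

    uv : Within Blue 1 u v
    -- `u` and `v` differ, since the empty walk also has length at most 2.
    uv with red⊎blue u v (λ { refl → far (0 , z≤n , []) })
    ... | inj₁ e = contradiction (1 , s≤s z≤n , e ∷ []) far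
    ... | inj₂ e = edge e

    -- Opposite ends cost 1 + 1 + 1 by way of the blue edge `uv`; a shared end costs only 1 + 1.
    join : Within Blue 1 x u ⊎ Within Blue 1 x v → Within Blue 1 y u ⊎ Within Blue 1 y v →
           Within Blue 3 x y
    join (inj₁ p) (inj₁ q) = within-mono (ℕ.n≤1+n 2) (within-trans p (within-sym q))
    join (inj₂ p) (inj₂ q) = within-mono (ℕ.n≤1+n 2) (within-trans p (within-sym q))
    join (inj₁ p) (inj₂ q) = within-trans p (within-trans uv (within-sym q))
    join (inj₂ p) (inj₁ q) = within-trans p (within-trans (within-sym uv) (within-sym q))

  -- Searching all pairs settles the colour: a pair at red distance above 2 selects blue, and
  -- without one red already achieves 2.
  monochromaticWithin3 : ∃[ x ] ∀ u v → Within (colourGraph c x Q) 3 u v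
  monochromaticWithin3 with anyVertex? Q (λ u → anyVertex? Q λ v → ¬? (within? Red 2 u v))
  ... | yes (u , v , far) = suc zero , blueWithin3 u v far
  ... | no none = zero , λ u v → within-mono (ℕ.n≤1+n 2)
    (decidable-stable (within? Red 2 u v) λ far → none (u , v , far))

  spanningSubgraph : Nonempty Q → Σ (Subgraph G) λ H →
    (Monochromatic c H × DiameterAtMost (graph H) 3) × Q ⊆ verts H
  spanningSubgraph ne with monochromaticWithin3
  ... | x , within = colourSubgraph c x Q ne ,
    (colourSubgraph-monochromatic c x Q ne , diameterAtMost (colourGraph c x Q) within) , id

-- From clique cover to monochromatic cover

module _ (G : Graph (Fin n)) where

  stable⇒independent : (S : Subset n) → IsStable G S → HasIndependentSet G ∣ S ∣
  stable⇒independent S st =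
    mk↣ {to = proj₁ ∘ enum S} (enum-injective S) ,
    λ i j → st _ _ (proj₂ (enum S i)) (proj₂ (enum S j))

  singleton-clique : ∀ v → IsClique G ⁅ v ⁆
  singleton-clique v x y x∈ y∈ x≢y =
    contradiction (trans (x∈⁅y⁆⇒x≡y v x∈) (sym (x∈⁅y⁆⇒x≡y v y∈))) x≢y

  -- The clique cover may contain empty cliques, while a `Subgraph` has a vertex; `v` fills the gap.
  nonemptyClique : Fin n → ∀ Q → IsClique G Q → ∃[ Q′ ] IsClique G Q′ × Nonempty Q′ × Q ⊆ Q′
  nonemptyClique v Q clique with nonempty? Q
  ... | yes ne = Q , clique , ne , id
  ... | no ¬ne = ⁅ v ⁆ , singleton-clique v , (v , x∈⁅x⁆ v) , λ x∈Q → contradiction (_ , x∈Q) ¬ne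

proposition1p3 : (n : ℕ) (G : Graph (Fin n)) → Perfect G →
    (c : EdgeColouring G 2) →
    (α : ℕ) → IsIndependenceNumber G α →
    Σ (Fin α → Subgraph G) λ H →
    (∀ i → Monochromatic c (H i) × DiameterAtMost (graph (H i)) 3) ×
    (∀ v → ∃[ i ] v ∈ verts (H i))
proposition1p3 n G perfect c α (independent , greatest)
  -- On the full vertex set, the stable bound is the maximality of `α`.
  with cliqueCover G perfect α ⊤ (λ S st _ → greatest ∣ S ∣ (stable⇒independent G S st))
... | Q , cliques , covers = proj₁ ∘ span , proj₁ ∘ proj₂ ∘ span , λ v →
  Product.map₂ (λ {i} v∈Q → proj₂ (proj₂ (span i)) v∈Q) (covers ∈⊤)
  where
  span : ∀ i → Σ (Subgraph G) λ H →
         (Monochromatic c H × DiameterAtMost (graph H) 3) × Q i ⊆ verts H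
  -- The fallback vertex is the `i`-th member of the given independent set of size `α`.
  span i with nonemptyClique G (Injection.to (proj₁ independent) i) (Q i) (cliques i)
  ... | Q′ , clique , ne , Q⊆Q′ with spanningSubgraph c clique ne
  ...   | H , good , Q′⊆ = H , good , Q′⊆ ∘ Q⊆Q′
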